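{- Let $p$ be a prime and let $w=(a_n)_{n=1}^\infty$ be an infinite word on the alphabet $\{0,1,\dots,p-1\}$ for which there are a sequence $(w_j)_{j=1}^\infty$ of finite non-empty words on this alphabet, with $m_j=|w_j|$, and a sequence of positive real numbers $(\delta_j)_{j=1}^\infty$ such that for every $j$ the word $w_jw_j^{\delta_j}$ occurs as a subword in $w$. Let $(\ell_j)_{j=1}^\infty$ be a sequence of natural numbers satisfying, for every $j$, $$p^{\ell_j-1}\le \frac{p^{m_j}-1}{\gcd\left(p^{m_j}-1,(w_j)_p^+\right)}\le p^{\ell_j}.$$ If $\lim_{j\to\infty}\left(m_j+\lfloor m_j\delta_j\rfloor-2\ell_j\right)=\infty$, then the real number $w_p=\sum_{n=1}^\infty a_np^{ -n}$ satisfies the $p$-adic Littlewood conjecture.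
   Context: Words: subwords are blocks of consecutive letters; $|v|$ denotes the length of a word $v$; juxtaposition denotes concatenation. For a finite non-empty word $v$ and a real $\delta>0$, $v^{\delta}$ denotes the prefix of length $\lfloor\delta\cdot|v|\rfloor$ of the periodic infinite word $vvv\cdots$ (so for $\delta<1$ it is the prefix of $v$ of that length). For a finite non-empty word $v=b_1b_2\cdots b_m$ on $\{0,1,\dots,p-1\}$, $v_p^+=\sum_{i=1}^m b_ip^{m-i}$ is the non-negative integer whose base-$p$ digits are given by $v$ (leading zeros allowed). The convention $\gcd(N,0)=N$ is used. A real number $x$ satisfies the $p$-adic Littlewood conjecture (pLC) if $\liminf_{q\to\infty} q\cdot|q|_p\cdot\|qx\|=0$, where $q$ runs over the positive integers, $|\cdot|_p$ is the $p$-adic absolute value and $\|\cdot\|$ is the distance to the nearest integer. -}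

module Defs where

open import Data.Bool.Base using (true; false)
open import Data.Fin.Base using (Fin; toℕ)
open import Data.Fin.Properties using (toℕ<n)
open import Data.Integer.Base as ℤ using (ℤ; +_; -[1+_])
import Data.Integer.Properties as ℤ
import Data.Integer.DivMod as ℤ
open import Data.List.Base as List using (List; []; _∷_; lookup; applyUpTo)
open import Data.List.NonEmpty.Base as List⁺ using (List⁺; toList)
open import Data.Nat.Base as ℕ using (ℕ; zero; suc; z≤n; s≤s)
import Data.Nat.Properties as ℕ
open import Data.Nat.Divisibility using (_∣_; _∣?_; divides; 1∣_; *-monoʳ-∣; *-cancelˡ-∣)
open import Data.Nat.DivMod using (_mod_)
open import Data.Nat.GCD using (gcd; gcd[m,n]≢0)
open import Data.Nat.Primality using (Prime; prime⇒nonZero; prime⇒nonTrivial)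
open import Data.Product.Base using (∃; _×_; _,_; proj₁; proj₂)
open import Data.Rational.Base
open import Data.Rational.Properties
open import Data.Rational.Solver using (module +-*-Solver)
open +-*-Solver using (solve; _:=_; _:+_; _:*_; _:-_; :-_; con)
open import Data.Rational.Unnormalised.Base as ℚᵘ using (mkℚᵘ)
import Data.Rational.Unnormalised.Properties as ℚᵘ
open import Data.Sum.Base using (inj₁; inj₂)
open import Relation.Binary.Definitions using (tri<; tri≈; tri>)
open import Relation.Binary.PropositionalEquality
open import Relation.Nullary using (¬_; yes; no)
open import Relation.Nullary.Negation using (contradiction)

ι : ℤ → ℚ
ι i = i / 1

/-mono-≤ : ∀ i d j e .{{_ : ℕ.NonZero d}} .{{_ : ℕ.NonZero e}} →
           i ℤ.* + e ℤ.≤ j ℤ.* + d → i / d ≤ j / e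
/-mono-≤ i (suc d) j (suc e) h = toℚᵘ-cancel-≤
  (ℚᵘ.≤-respʳ-≃ (ℚᵘ.≃-sym (toℚᵘ-fromℚᵘ (mkℚᵘ j e)))
    (ℚᵘ.≤-respˡ-≃ (ℚᵘ.≃-sym (toℚᵘ-fromℚᵘ (mkℚᵘ i d))) (ℚᵘ.*≤* h)))

/-mono-< : ∀ i d j e .{{_ : ℕ.NonZero d}} .{{_ : ℕ.NonZero e}} →
           i ℤ.* + e ℤ.< j ℤ.* + d → i / d < j / e
/-mono-< i (suc d) j (suc e) h = toℚᵘ-cancel-<
  (ℚᵘ.<-respʳ-≃ (ℚᵘ.≃-sym (toℚᵘ-fromℚᵘ (mkℚᵘ j e)))
    (ℚᵘ.<-respˡ-≃ (ℚᵘ.≃-sym (toℚᵘ-fromℚᵘ (mkℚᵘ i d))) (ℚᵘ.*<* h)))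

/-+ : ∀ i j d .{{_ : ℕ.NonZero d}} → i / d + j / d ≡ (i ℤ.+ j) / d
/-+ i j (suc d) = toℚᵘ-injective (begin
  toℚᵘ (i / suc d + j / suc d)
    ≈⟨ toℚᵘ-homo-+ (i / suc d) (j / suc d) ⟩
  toℚᵘ (i / suc d) ℚᵘ.+ toℚᵘ (j / suc d)
    ≈⟨ ℚᵘ.+-cong (toℚᵘ-fromℚᵘ (mkℚᵘ i d)) (toℚᵘ-fromℚᵘ (mkℚᵘ j d)) ⟩
  mkℚᵘ i d ℚᵘ.+ mkℚᵘ j d
    ≈⟨ ℚᵘ.*≡* (trans (cong (ℤ._* + suc d) (sym (ℤ.*-distribʳ-+ (+ suc d) i j)))
                     (trans (ℤ.*-assoc (i ℤ.+ j) (+ suc d) (+ suc d))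
                            refl)) ⟩
  mkℚᵘ (i ℤ.+ j) d
    ≈⟨ ℚᵘ.≃-sym (toℚᵘ-fromℚᵘ (mkℚᵘ (i ℤ.+ j) d)) ⟩
  toℚᵘ ((i ℤ.+ j) / suc d) ∎)
  where open ℚᵘ.≃-Reasoning

ι-mono-≤ : ∀ {i j} → i ℤ.≤ j → ι i ≤ ι j
ι-mono-≤ {i} {j} h = /-mono-≤ i 1 j 1 (ℤ.*-monoʳ-≤-nonNeg (+ 1) h)

ι-neg : ∀ i → ι (ℤ.- i) ≡ - ι i
ι-neg i = +-cancel (begin
  ι (ℤ.- i) + ι i  ≡⟨ /-+ (ℤ.- i) i 1 ⟩
  ι (ℤ.- i ℤ.+ i)  ≡⟨ cong ι (ℤ.+-inverseˡ i) ⟩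
  0ℚ               ≡⟨ +-inverseˡ (ι i) ⟨
  - ι i + ι i      ∎)
  where
  open ≡-Reasoning
  +-cancel : ∀ {x y z : ℚ} → x + z ≡ y + z → x ≡ y
  +-cancel {x} {y} {z} h = begin
    x            ≡⟨ solve 2 (λ x z → x := x :+ z :- z) refl x z ⟩
    x + z - z    ≡⟨ cong (_- z) h ⟩
    y + z - z    ≡⟨ solve 2 (λ y z → y :+ z :- z := y) refl y z ⟩
    y            ∎

floor-≤ : ∀ x → ι (floor x) ≤ x
floor-≤ x@record{} = subst (ι (floor x) ≤_) (↥p/↧p≡p x)
  (/-mono-≤ (floor x) 1 (↥ x) (↧ₙ x)
    (subst (floor x ℤ.* ↧ x ℤ.≤_) (sym (ℤ.*-identityʳ (↥ x)))
      (ℤ.[n/d]*d≤n (↥ x) (↧ x))))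

floor-> : ∀ x → x < ι (floor x) + 1ℚ
floor-> x@record{} = subst₂ _<_ (↥p/↧p≡p x) eq
  (/-mono-< (↥ x) (↧ₙ x) (ℤ.suc (floor x)) 1
    (subst (ℤ._< ℤ.suc (floor x) ℤ.* ↧ x) (sym (ℤ.*-identityʳ (↥ x)))
      (subst (λ t → ↥ x ℤ.< ℤ.suc t ℤ.* ↧ x) (sym (ℤ.div-pos-is-/ℕ (↥ x) (↧ₙ x)))
        (ℤ.n<s[n/ℕd]*d (↥ x) (↧ₙ x)))))
  where
  eq : ι (ℤ.suc (floor x)) ≡ ι (floor x) + 1ℚ
  eq = trans (sym (/-+ (+ 1) (floor x) 1)) (+-comm 1ℚ (ι (floor x)))

-≤⇒∣∣≤ : ∀ {x c} → x ≤ c → - x ≤ c → ∣ x ∣ ≤ c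
-≤⇒∣∣≤ {x} h₁ h₂ with ∣p∣≡p∨∣p∣≡-p x
... | inj₁ e = ≤-trans (≤-reflexive e) h₁
... | inj₂ e = ≤-trans (≤-reflexive e) h₂

x≤∣x∣ : ∀ x → x ≤ ∣ x ∣
x≤∣x∣ x with ≤-total 0ℚ x
... | inj₁ h = ≤-reflexive (sym (0≤p⇒∣p∣≡p h))
... | inj₂ h = ≤-trans h (0≤∣p∣ x)

-x≤∣x∣ : ∀ x → - x ≤ ∣ x ∣
-x≤∣x∣ x = ≤-trans (x≤∣x∣ (- x)) (≤-reflexive (∣-p∣≡∣p∣ x))

shift-≤ : ∀ {x y} c → x ≤ y → x + c ≤ y + c
shift-≤ c = +-monoˡ-≤ c

within-½ : ∀ {x z} → z ≤ x + ½ → x - ½ ≤ z → ∣ x - z ∣ ≤ ½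
within-½ {x} {z} h₁ h₂ = -≤⇒∣∣≤
  (subst₂ _≤_ (solve 2 (λ x z → x :- con ½ :+ (con ½ :- z) := x :- z) refl x z)
              (solve 1 (λ z → z :+ (con ½ :- z) := con ½) refl z)
              (shift-≤ (½ - z) h₂))
  (subst₂ _≤_ (solve 2 (λ x z → z :+ (:- x) := :- (x :- z)) refl x z)
              (solve 1 (λ x → x :+ con ½ :+ (:- x) := con ½) refl x)
              (shift-≤ (- x) h₁))

floor-near : ∀ x → ∣ x - ι (floor (x + ½)) ∣ ≤ ½
floor-near x = within-½ {x} (floor-≤ (x + ½))
  (subst₂ _≤_ (solve 1 (λ x → x :+ con ½ :+ con (- 1ℚ) := x :- con ½) refl x)
              (solve 1 (λ f → f :+ con 1ℚ :+ con (- 1ℚ) := f) refl f)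
              (shift-≤ (- 1ℚ) (<⇒≤ (floor-> (x + ½)))))
  where f = ι (floor (x + ½))

ceiling-neg : ∀ x → ceiling x ≡ ℤ.- floor (- x)
ceiling-neg record{} = refl

ceiling-near : ∀ x → ∣ x - ι (ceiling (x - ½)) ∣ ≤ ½
ceiling-near x = subst (_≤ ½) eq (floor-near (- x))
  where
  open ≡-Reasoning
  f = floor (- x + ½)
  eq : ∣ - x - ι f ∣ ≡ ∣ x - ι (ceiling (x - ½)) ∣
  eq = begin
    ∣ - x - ι f ∣          ≡⟨ ∣-p∣≡∣p∣ (- x - ι f) ⟨
    ∣ - (- x - ι f) ∣      ≡⟨ cong ∣_∣ (solve 2 (λ x f → :- (:- x :- f) := x :- (:- f)) refl x (ι f)) ⟩
    ∣ x - (- ι f) ∣        ≡⟨ cong (λ t → ∣ x - t ∣) (ι-neg f) ⟨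
    ∣ x - ι (ℤ.- f) ∣      ≡⟨ cong (λ t → ∣ x - ι (ℤ.- floor t) ∣)
                                (solve 1 (λ x → :- x :+ con ½ := :- (x :- con ½)) refl x) ⟩
    ∣ x - ι (ℤ.- floor (- (x - ½))) ∣  ≡⟨ cong (λ t → ∣ x - ι t ∣) (ceiling-neg (x - ½)) ⟨
    ∣ x - ι (ceiling (x - ½)) ∣  ∎

round-near : ∀ x → ∣ x - ι (round x) ∣ ≤ ½
round-near x with x ≤ᵇ 0ℚ
... | true  = ceiling-near x
... | false = floor-near x

‖_‖ℚ : ℚ → ℚ
‖ x ‖ℚ = ∣ x - ι (round x) ∣

ι-suc : ∀ i → ι (ℤ.suc i) ≡ 1ℚ + ι i
ι-suc i = sym (/-+ (+ 1) i 1)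

private
  gap : ∀ x {i j} → i ℤ.< j → 1ℚ ≤ ∣ x - ι i ∣ + ∣ x - ι j ∣
  gap x {i} {j} i<j = begin
    1ℚ                          ≡⟨ solve 1 (λ a → con 1ℚ := con 1ℚ :+ a :+ (:- a)) refl (ι i) ⟩
    1ℚ + ι i - ι i              ≡⟨ cong (_- ι i) (ι-suc i) ⟨
    ι (ℤ.suc i) - ι i           ≤⟨ shift-≤ (- ι i) (ι-mono-≤ (ℤ.i<j⇒suc[i]≤j i<j)) ⟩
    ι j - ι i                   ≡⟨ solve 3 (λ x a b → b :- a := (x :- a) :+ (:- (x :- b))) refl x (ι i) (ι j) ⟩
    (x - ι i) - (x - ι j)       ≤⟨ +-mono-≤ (x≤∣x∣ (x - ι i)) (-x≤∣x∣ (x - ι j)) ⟩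
    ∣ x - ι i ∣ + ∣ x - ι j ∣   ∎
    where open ≤-Reasoning

  ½≤ : ∀ {a b} → b ≤ ½ → 1ℚ ≤ a + b → b ≤ a
  ½≤ {a} {b} b≤½ h = begin
    b            ≤⟨ b≤½ ⟩
    ½            ≡⟨⟩
    1ℚ - ½       ≤⟨ +-mono-≤ h (neg-antimono-≤ b≤½) ⟩
    a + b - b    ≡⟨ solve 2 (λ a b → a :+ b :- b := a) refl a b ⟩
    a            ∎
    where open ≤-Reasoning

‖‖ℚ-minimal : ∀ x n → ‖ x ‖ℚ ≤ ∣ x - ι n ∣
‖‖ℚ-minimal x n with ℤ.<-cmp n (round x)
... | tri< n<r _ _ = ½≤ (round-near x) (gap x n<r)
... | tri≈ _ refl _ = ≤-refl
... | tri> _ _ r<n = ½≤ (round-near x)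
  (subst (1ℚ ≤_) (+-comm ∣ x - ι (round x) ∣ ∣ x - ι n ∣) (gap x r<n))

‖‖ℚ-lipschitz : ∀ x y → ∣ ‖ x ‖ℚ - ‖ y ‖ℚ ∣ ≤ ∣ x - y ∣
‖‖ℚ-lipschitz x y = -≤⇒∣∣≤ (half x y)
  (subst₂ _≤_ (solve 2 (λ a b → b :- a := :- (a :- b)) refl ‖ x ‖ℚ ‖ y ‖ℚ)
              (trans (sym (∣-p∣≡∣p∣ (y - x)))
                     (cong ∣_∣ (solve 2 (λ x y → :- (y :- x) := x :- y) refl x y)))
              (half y x))
  where
  open ≤-Reasoning
  half : ∀ x y → ‖ x ‖ℚ - ‖ y ‖ℚ ≤ ∣ x - y ∣
  half x y = begin
    ‖ x ‖ℚ - ‖ y ‖ℚ                       ≤⟨ shift-≤ (- ‖ y ‖ℚ) (‖‖ℚ-minimal x (round y)) ⟩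
    ∣ x - r ∣ - ‖ y ‖ℚ                    ≡⟨ cong (λ t → ∣ t ∣ - ‖ y ‖ℚ)
                                               (solve 3 (λ x y r → x :- r := (x :- y) :+ (y :- r)) refl x y r) ⟩
    ∣ (x - y) + (y - r) ∣ - ‖ y ‖ℚ        ≤⟨ shift-≤ (- ‖ y ‖ℚ) (∣p+q∣≤∣p∣+∣q∣ (x - y) (y - r)) ⟩
    ∣ x - y ∣ + ‖ y ‖ℚ - ‖ y ‖ℚ           ≡⟨ solve 2 (λ a b → a :+ b :- b := a) refl ∣ x - y ∣ ‖ y ‖ℚ ⟩
    ∣ x - y ∣                             ∎
    where r = ι (round y)

-- Real numbers are Cauchy sequences of rationals.  Distinct sequences may
-- represent the same real; every predicate below depends only on the limit.
record ℝ : Set where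
  field
    seq    : ℕ → ℚ
    cauchy : ∀ ε → 0ℚ < ε → ∃ λ N → ∀ m n → N ℕ.≤ m → N ℕ.≤ n →
             ∣ seq m - seq n ∣ < ε

open ℝ public

infix 4 _<ᵣ_ _≤ᵣ_
infixr 7 _·_

fromℚ : ℚ → ℝ
fromℚ q .seq _ = q
fromℚ q .cauchy ε ε>0 = 0 , λ _ _ _ _ →
  subst (_< ε) (sym (cong ∣_∣ (+-inverseʳ q))) ε>0

_<ᵣ_ : ℝ → ℝ → Set
x <ᵣ y = ∃ λ ε → 0ℚ < ε × ∃ λ N → ∀ n → N ℕ.≤ n → seq x n + ε ≤ seq y n

_≤ᵣ_ : ℝ → ℝ → Set
x ≤ᵣ y = ¬ (y <ᵣ x)

IsFloor : ℝ → ℤ → Set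
IsFloor x k = fromℚ (ι k) ≤ᵣ x × x <ᵣ fromℚ (ι (ℤ.suc k))

_·_ : ℚ → ℝ → ℝ
(q · x) .seq n = q * seq x n
(q · x) .cauchy ε ε>0 = N , λ m n N≤m N≤n → begin-strict
  ∣ q * seq x m - q * seq x n ∣  ≡⟨ cong ∣_∣ (solve 3 (λ q a b → q :* a :- q :* b := q :* (a :- b)) refl q (seq x m) (seq x n)) ⟩
  ∣ q * (seq x m - seq x n) ∣    ≡⟨ ∣p*q∣≡∣p∣*∣q∣ q (seq x m - seq x n) ⟩
  ∣ q ∣ * ∣ seq x m - seq x n ∣  ≤⟨ *-monoʳ-≤-nonNeg ∣ seq x m - seq x n ∣ ⦃ ∣-∣-nonNeg (seq x m - seq x n) ⦄ ∣q∣≤c ⟩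
  c * ∣ seq x m - seq x n ∣      <⟨ *-monoʳ-<-pos c (bound m n N≤m N≤n) ⟩
  c * (1/ c * ε)                 ≡⟨ *-assoc c (1/ c) ε ⟨
  c * 1/ c * ε                   ≡⟨ cong (_* ε) (*-inverseʳ c) ⟩
  1ℚ * ε                         ≡⟨ *-identityˡ ε ⟩
  ε                              ∎
  where
  open ≤-Reasoning
  c = ∣ q ∣ + 1ℚ
  instance
    c-pos : Positive c
    c-pos = nonNeg+pos⇒pos ∣ q ∣ ⦃ ∣-∣-nonNeg q ⦄ 1ℚ
    c-nonZero : NonZero c
    c-nonZero = pos⇒nonZero c
  ∣q∣≤c : ∣ q ∣ ≤ c
  ∣q∣≤c = subst (_≤ c) (+-identityʳ ∣ q ∣) (+-monoʳ-≤ ∣ q ∣ (nonNegative⁻¹ 1ℚ))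
  δ>0 : 0ℚ < 1/ c * ε
  δ>0 = positive⁻¹ (1/ c * ε) ⦃ pos*pos⇒pos (1/ c) ⦃ 1/pos⇒pos c ⦄ ε ⦃ positive ε>0 ⦄ ⦄
  N     = proj₁ (cauchy x (1/ c * ε) δ>0)
  bound = proj₂ (cauchy x (1/ c * ε) δ>0)

-- The distance to the nearest integer is 1-Lipschitz, so it extends from ℚ
-- to ℝ termwise.
‖_‖ : ℝ → ℝ
‖ x ‖ .seq n = ‖ seq x n ‖ℚ
‖ x ‖ .cauchy ε ε>0 with cauchy x ε ε>0
... | N , h = N , λ m n N≤m N≤n →
  ≤-<-trans (‖‖ℚ-lipschitz (seq x m) (seq x n)) (h m n N≤m N≤n)

LimInf≡ : (ℕ → ℝ) → ℚ → Set
LimInf≡ f L = ∀ ε → 0ℚ < ε →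
  (∃ λ N → ∀ n → N ℕ.≤ n → fromℚ (L - ε) <ᵣ f n) ×
  (∀ N → ∃ λ n → N ℕ.≤ n × f n <ᵣ fromℚ (L + ε))

TendsTo+∞ : (ℕ → ℤ) → Set
TendsTo+∞ f = ∀ M → ∃ λ J → ∀ j → J ℕ.≤ j → M ℤ.≤ f j

module _ {A : Set} where

  _^∞ : List⁺ A → ℕ → A
  (v ^∞) i = lookup (toList v) (i mod List.length (toList v))

  -- For a real δ, the word v^δ is  prefix (v ^∞) k  with k = ⌊δ·|v|⌋.
  prefix : (ℕ → A) → ℕ → List A
  prefix = applyUpTo

  _OccursIn_ : List A → (ℕ → A) → Set
  u OccursIn a = ∃ λ n → ∀ (i : Fin (List.length u)) → lookup u i ≡ a (n ℕ.+ toℕ i)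

valueₚ : ∀ {p} → List (Fin p) → ℕ
valueₚ         []       = 0
valueₚ {p = p} (b ∷ bs) = toℕ b ℕ.* p ℕ.^ List.length bs ℕ.+ valueₚ bs

_⁺ₚ : ∀ {p} → List⁺ (Fin p) → ℕ
v ⁺ₚ = valueₚ (toList v)

module _ {p : ℕ} (p-prime : Prime p) where

  private instance
    p-nonZero : ℕ.NonZero p
    p-nonZero = prime⇒nonZero p-prime
    p-nonTrivial : ℕ.NonTrivial p
    p-nonTrivial = prime⇒nonTrivial p-prime

  1<p : 1 ℕ.< p
  1<p = ℕ.nonTrivial⇒n>1 p

  valuation : ∀ q .{{_ : ℕ.NonZero q}} →
              ∃ λ k → p ℕ.^ k ∣ q × ¬ (p ℕ.^ suc k ∣ q)
  valuation q = go q q ℕ.≤-refl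
    where
    go : ∀ fuel q .{{_ : ℕ.NonZero q}} → q ℕ.≤ fuel →
         ∃ λ k → p ℕ.^ k ∣ q × ¬ (p ℕ.^ suc k ∣ q)
    go zero    (suc _) ()
    go (suc f) q q≤ with p ∣? q
    ... | no p∤q = 0 , 1∣ q , λ h → p∤q (subst (_∣ q) (ℕ.*-identityʳ p) h)
    ... | yes (divides zero    refl) = contradiction refl (ℕ.≢-nonZero⁻¹ 0)
    ... | yes (divides (suc r) refl) with go f (suc r)
            (ℕ.≤-pred (ℕ.≤-trans (ℕ.m<m*n (suc r) p 1<p) q≤))
    ...   | k , pᵏ∣ , pᵏ⁺¹∤ = suc k ,
            subst (p ℕ.^ suc k ∣_) (ℕ.*-comm p (suc r)) (*-monoʳ-∣ p pᵏ∣) ,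
            λ h → pᵏ⁺¹∤ (*-cancelˡ-∣ p (subst (p ℕ.^ suc (suc k) ∣_) (ℕ.*-comm (suc r) p) h))

  over : ℤ → ℕ → ℚ
  over i n = (i / p ℕ.^ n) ⦃ ℕ.m^n≢0 p n ⦄

  ∣_∣ₚ : ∀ q .{{_ : ℕ.NonZero q}} → ℚ
  ∣ q ∣ₚ = over (+ 1) (proj₁ (valuation q))

  -- The n-th entry of the sequence is q·|q|_p·‖qx‖ for q = n + 1.
  pLC : ℝ → Set
  pLC x = LimInf≡ (λ n → (ι (+ suc n) * ∣ suc n ∣ₚ) · ‖ ι (+ suc n) · x ‖) 0ℚ

  partialSum : (ℕ → Fin p) → ℕ → ℚ
  partialSum a zero    = 0ℚ
  partialSum a (suc n) = partialSum a n + over (+ toℕ (a n)) (suc n)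

  over-digit : ∀ (d : Fin p) n → over (+ toℕ d) (suc n) + over (+ 1) (suc n) ≤ over (+ 1) n
  over-digit d n = ≤-trans (≤-reflexive (/-+ (+ toℕ d) (+ 1) (p ℕ.^ suc n) ⦃ ℕ.m^n≢0 p (suc n) ⦄))
    (/-mono-≤ (+ toℕ d ℤ.+ + 1) (p ℕ.^ suc n) (+ 1) (p ℕ.^ n) ⦃ ℕ.m^n≢0 p (suc n) ⦄ ⦃ ℕ.m^n≢0 p n ⦄
      (subst₂ ℤ._≤_ (ℤ.pos-* (toℕ d ℕ.+ 1) (p ℕ.^ n)) (sym (ℤ.*-identityˡ (+ (p ℕ.* p ℕ.^ n))))
        (ℤ.+≤+ (ℕ.*-monoˡ-≤ (p ℕ.^ n) (subst (ℕ._≤ p) (ℕ.+-comm 1 (toℕ d)) (toℕ<n d))))))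

  over-nonNeg : ∀ k n → 0ℚ ≤ over (+ k) n
  over-nonNeg k n = nonNegative⁻¹ (over (+ k) n) ⦃ normalize-nonNeg k (p ℕ.^ n) ⦃ ℕ.m^n≢0 p n ⦄ ⦄

  partialSum-mono : ∀ a n k → partialSum a n ≤ partialSum a (k ℕ.+ n)
  partialSum-mono a n zero    = ≤-refl
  partialSum-mono a n (suc k) = ≤-trans (partialSum-mono a n k)
    (subst (_≤ partialSum a (suc k ℕ.+ n)) (+-identityʳ (partialSum a (k ℕ.+ n)))
      (+-monoʳ-≤ (partialSum a (k ℕ.+ n)) (over-nonNeg (toℕ (a (k ℕ.+ n))) (suc (k ℕ.+ n)))))

  partialSum-tail : ∀ a n k → partialSum a (k ℕ.+ n) + over (+ 1) (k ℕ.+ n) ≤ partialSum a n + over (+ 1) n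
  partialSum-tail a n zero    = ≤-refl
  partialSum-tail a n (suc k) = ≤-trans
    (≤-trans (≤-reflexive (+-assoc (partialSum a (k ℕ.+ n)) _ _))
             (+-monoʳ-≤ (partialSum a (k ℕ.+ n)) (over-digit (a (k ℕ.+ n)) (k ℕ.+ n))))
    (partialSum-tail a n k)

  n<p^n : ∀ n → n ℕ.< p ℕ.^ n
  n<p^n zero    = s≤s z≤n
  n<p^n (suc n) = ℕ.≤-<-trans (n<p^n n)
    (ℕ.<-≤-trans (ℕ.m<m*n (p ℕ.^ n) p ⦃ ℕ.m^n≢0 p n ⦄ 1<p) (ℕ.≤-reflexive (ℕ.*-comm (p ℕ.^ n) p)))

  over-small : ∀ ε → 0ℚ < ε → ∃ λ N → over (+ 1) N < ε
  over-small ε@(mkℚ (+ zero)  d _) ε>0 = contradiction (drop-*<* ε>0) (ℤ.<-irrefl refl)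
  over-small ε@(mkℚ -[1+ n ]  d _) ε>0 with drop-*<* ε>0
  ... | ()
  over-small ε@(mkℚ (+ suc i) d _) ε>0 = suc d , subst (over (+ 1) (suc d) <_) (↥p/↧p≡p ε)
    (/-mono-< (+ 1) (p ℕ.^ suc d) (+ suc i) (suc d) ⦃ ℕ.m^n≢0 p (suc d) ⦄
      (subst₂ ℤ._<_ (sym (ℤ.*-identityˡ (+ suc d))) (ℤ.pos-* (suc i) (p ℕ.^ suc d))
        (ℤ.+<+ (ℕ.<-≤-trans (n<p^n (suc d)) (ℕ.m≤n*m (p ℕ.^ suc d) (suc i))))))

  -- The real number Σ aₙ p⁻ⁿ, where a 0 , a 1 , … are a₁ , a₂ , …
  toReal : (ℕ → Fin p) → ℝ
  toReal a .seq = partialSum a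
  toReal a .cauchy ε ε>0 with over-small ε ε>0
  ... | N , small = N , λ m n N≤m N≤n → ≤-<-trans
    (-≤⇒∣∣≤ (half m n N≤m N≤n)
      (subst (_≤ over (+ 1) N)
        (solve 2 (λ x y → y :- x := :- (x :- y)) refl (S m) (S n)) (half n m N≤n N≤m)))
    small
    where
    open ≤-Reasoning
    S = partialSum a
    lower : ∀ n → N ℕ.≤ n → S N ≤ S n
    lower n N≤n = subst (λ t → S N ≤ S t) (ℕ.m∸n+n≡m N≤n) (partialSum-mono a N (n ℕ.∸ N))
    upper : ∀ n → N ℕ.≤ n → S n ≤ S N + over (+ 1) N
    upper n N≤n = begin
      S n                   ≡⟨ +-identityʳ (S n) ⟨
      S n + 0ℚ              ≤⟨ +-monoʳ-≤ (S n) (over-nonNeg 1 n) ⟩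
      S n + over (+ 1) n    ≤⟨ subst (λ t → S t + over (+ 1) t ≤ S N + over (+ 1) N)
                                 (ℕ.m∸n+n≡m N≤n) (partialSum-tail a N (n ℕ.∸ N)) ⟩
      S N + over (+ 1) N    ∎
    half : ∀ m n → N ℕ.≤ m → N ℕ.≤ n → S m - S n ≤ over (+ 1) N
    half m n N≤m N≤n = begin
      S m - S n                     ≤⟨ +-mono-≤ (upper m N≤m) (neg-antimono-≤ (lower n N≤n)) ⟩
      S N + over (+ 1) N - S N      ≡⟨ solve 2 (λ a b → a :+ b :- a := b) refl (S N) (over (+ 1) N) ⟩
      over (+ 1) N                  ∎

  p^m∸1≢0 : ∀ (v : List⁺ (Fin p)) → p ℕ.^ List⁺.length v ℕ.∸ 1 ≢ 0
  p^m∸1≢0 v = ℕ.m>n⇒m∸n≢0 (ℕ.≤-<-trans (s≤s z≤n) (n<p^n (List⁺.length v)))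

  -- p^|v| ≥ 2, so ∸ does not truncate; gcd N 0 = N.
  ratio : List⁺ (Fin p) → ℚ
  ratio v = (+ (p ℕ.^ List⁺.length v ℕ.∸ 1) / gcd (p ℕ.^ List⁺.length v ℕ.∸ 1) (v ⁺ₚ))
    ⦃ ℕ.≢-nonZero (gcd[m,n]≢0 _ _ (inj₁ (p^m∸1≢0 v))) ⦄

  -- The rational number pⁿ⁻¹, equal to 1/p at n = 0.
  p^[_-1] : ℕ → ℚ
  p^[ n -1] = + (p ℕ.^ n) / p

{-# OPTIONS --safe #-}
-- If w = w_j has length m, then 0.www… = w⁺/(p^m - 1) = u/d in lowest terms,
-- and d ≤ p^ℓ.  When the word w w^δ, of length L, starts after the first n
-- letters, d pⁿ x is within d p^-L of an integer, so q = d pⁿ⁺ᵗ satisfies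
-- q |q|_p ‖qx‖ ≤ d · d pᵗ p^-L ≤ p^(t+2ℓ-L).  The extra factor pᵗ does not
-- change q |q|_p and forces q to be large, even if d and n stay bounded in j.
module Submission where

open import Defs
open import Data.Fin.Base using (Fin; toℕ)
open import Data.Fin.Properties using (toℕ<n; toℕ-injective; toℕ-fromℕ<)
import Data.Fin.Base as Fin
open import Data.Integer.Base as ℤ using (+_)
import Data.Integer.Properties as ℤ
open import Data.List.Base as List using (List; []; _∷_; _++_; lookup; applyUpTo)
open import Data.List.Properties using (length-++; length-applyUpTo; applyUpTo-∷ʳ)
open import Data.List.NonEmpty.Base using (List⁺; toList; length)
open import Data.Nat.Base as ℕ using (ℕ; zero; suc)
import Data.Nat.Properties as ℕ
open import Data.Nat.Divisibility using (_∣_; divides; ∣-trans; m∣m*n; n∣m*n)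
open import Data.Nat.DivMod using (m<n⇒m%n≡m; [m+n]%n≡m%n; m%n<n)
open import Data.Nat.GCD using (gcd; gcd[m,n]∣m; gcd[m,n]∣n; gcd[m,n]≢0)
open import Data.Nat.Primality using (Prime; prime⇒nonZero)
open import Data.Nat.Tactic.RingSolver using (solve-∀)
open import Data.Product.Base using (_×_; _,_; ∃; proj₁; proj₂)
open import Data.Rational.Base
open import Data.Rational.Properties
open import Data.Rational.Solver using (module +-*-Solver)
open import Data.Rational.Unnormalised.Base as ℚᵘ using (mkℚᵘ)
import Data.Rational.Unnormalised.Properties as ℚᵘ
open import Data.Sum.Base using (inj₁)
open import Function.Base using (_∘_)
open import Relation.Binary.PropositionalEquality

-- Periodic words and their prefixes

module _ {A : Set} where

  applyUpTo-cong : ∀ {f g : ℕ → A} → (∀ i → f i ≡ g i) → ∀ n → applyUpTo f n ≡ applyUpTo g n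
  applyUpTo-cong f≗g zero    = refl
  applyUpTo-cong f≗g (suc n) = cong₂ _∷_ (f≗g 0) (applyUpTo-cong (f≗g ∘ suc) n)

  applyUpTo-+ : ∀ (f : ℕ → A) m n → applyUpTo f (m ℕ.+ n) ≡ applyUpTo f m ++ applyUpTo (f ∘ (m ℕ.+_)) n
  applyUpTo-+ f zero    n = refl
  applyUpTo-+ f (suc m) n = cong (f 0 ∷_) (applyUpTo-+ (f ∘ suc) m n)

  lookup⇒applyUpTo : ∀ (f : ℕ → A) xs → (∀ i → lookup xs i ≡ f (toℕ i)) →
                     xs ≡ applyUpTo f (List.length xs)
  lookup⇒applyUpTo f []       h = refl
  lookup⇒applyUpTo f (x ∷ xs) h = cong₂ _∷_ (h Fin.zero) (lookup⇒applyUpTo (f ∘ suc) xs (h ∘ Fin.suc))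

  ^∞-periodic : ∀ (v : List⁺ A) i → (v ^∞) (length v ℕ.+ i) ≡ (v ^∞) i
  ^∞-periodic v i = cong (lookup (toList v)) (toℕ-injective (begin
    toℕ (Fin.fromℕ< (m%n<n (m ℕ.+ i) m))  ≡⟨ toℕ-fromℕ< (m%n<n (m ℕ.+ i) m) ⟩
    (m ℕ.+ i) ℕ.% m                       ≡⟨ cong (ℕ._% m) (ℕ.+-comm m i) ⟩
    (i ℕ.+ m) ℕ.% m                       ≡⟨ [m+n]%n≡m%n i m ⟩
    i ℕ.% m                               ≡⟨ toℕ-fromℕ< (m%n<n i m) ⟨
    toℕ (Fin.fromℕ< (m%n<n i m))          ∎))
    where
    open ≡-Reasoning
    m = length v

  prefix-length : ∀ (v : List⁺ A) → toList v ≡ prefix (v ^∞) (length v)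
  prefix-length v = lookup⇒applyUpTo (v ^∞) (toList v) λ i →
    cong (lookup (toList v)) (sym (toℕ-injective
      (trans (toℕ-fromℕ< (m%n<n (toℕ i) (length v))) (m<n⇒m%n≡m (toℕ<n i)))))

  -- Deleting the first `v` from `vvv⋯` leaves it unchanged, so the repeated word in the hypothesis
  -- can be handled as a single prefix of `v ^∞`.
  prefix-+ : ∀ (v : List⁺ A) k → toList v ++ prefix (v ^∞) k ≡ prefix (v ^∞) (length v ℕ.+ k)
  prefix-+ v k = sym (trans (applyUpTo-+ (v ^∞) (length v) k)
    (cong₂ _++_ (sym (prefix-length v)) (applyUpTo-cong (^∞-periodic v) k)))

-- Base-p values of words

module _ {p : ℕ} where

  valueₚ-++ : ∀ (xs ys : List (Fin p)) →
              valueₚ (xs ++ ys) ≡ valueₚ xs ℕ.* p ℕ.^ List.length ys ℕ.+ valueₚ ys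
  valueₚ-++ []       ys = refl
  valueₚ-++ (x ∷ xs) ys = begin
    toℕ x ℕ.* p ℕ.^ List.length (xs ++ ys) ℕ.+ valueₚ (xs ++ ys)
      ≡⟨ cong₂ (λ e r → toℕ x ℕ.* e ℕ.+ r)
           (trans (cong (p ℕ.^_) (length-++ xs)) (ℕ.^-distribˡ-+-* p (List.length xs) (List.length ys)))
           (valueₚ-++ xs ys) ⟩
    toℕ x ℕ.* (p ℕ.^ List.length xs ℕ.* Y) ℕ.+ (valueₚ xs ℕ.* Y ℕ.+ valueₚ ys)
      ≡⟨ rearrange (toℕ x) (p ℕ.^ List.length xs) (valueₚ xs) Y (valueₚ ys) ⟩
    (toℕ x ℕ.* p ℕ.^ List.length xs ℕ.+ valueₚ xs) ℕ.* Y ℕ.+ valueₚ ys  ∎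
    where
    open ≡-Reasoning
    Y = p ℕ.^ List.length ys
    rearrange : ∀ x e v y w → x ℕ.* (e ℕ.* y) ℕ.+ (v ℕ.* y ℕ.+ w) ≡ (x ℕ.* e ℕ.+ v) ℕ.* y ℕ.+ w
    rearrange = solve-∀

  valueₚ< : ∀ (xs : List (Fin p)) → valueₚ xs ℕ.< p ℕ.^ List.length xs
  valueₚ< []       = ℕ.≤-refl
  valueₚ< (x ∷ xs) = begin-strict
    toℕ x ℕ.* e ℕ.+ valueₚ xs  <⟨ ℕ.+-monoʳ-< (toℕ x ℕ.* e) (valueₚ< xs) ⟩
    toℕ x ℕ.* e ℕ.+ e          ≡⟨ ℕ.+-comm (toℕ x ℕ.* e) e ⟩
    suc (toℕ x) ℕ.* e          ≤⟨ ℕ.*-monoˡ-≤ e (toℕ<n x) ⟩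
    p ℕ.* e                    ∎
    where
    open ℕ.≤-Reasoning
    e = p ℕ.^ List.length xs

  valueₚ-applyUpTo< : ∀ (f : ℕ → Fin p) n → valueₚ (applyUpTo f n) ℕ.< p ℕ.^ n
  valueₚ-applyUpTo< f n = subst (λ k → valueₚ (applyUpTo f n) ℕ.< p ℕ.^ k)
    (length-applyUpTo f n) (valueₚ< (applyUpTo f n))

  valueₚ-applyUpTo-+ : ∀ (f : ℕ → Fin p) m n → valueₚ (applyUpTo f (m ℕ.+ n)) ≡
    valueₚ (applyUpTo f m) ℕ.* p ℕ.^ n ℕ.+ valueₚ (applyUpTo (f ∘ (m ℕ.+_)) n)
  valueₚ-applyUpTo-+ f m n = begin
    valueₚ (applyUpTo f (m ℕ.+ n))  ≡⟨ cong valueₚ (applyUpTo-+ f m n) ⟩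
    valueₚ (xs ++ ys)               ≡⟨ valueₚ-++ xs ys ⟩
    valueₚ xs ℕ.* p ℕ.^ List.length ys ℕ.+ valueₚ ys
      ≡⟨ cong (λ k → valueₚ xs ℕ.* p ℕ.^ k ℕ.+ valueₚ ys) (length-applyUpTo _ n) ⟩
    valueₚ xs ℕ.* p ℕ.^ n ℕ.+ valueₚ ys  ∎
    where
    open ≡-Reasoning
    xs = applyUpTo f m
    ys = applyUpTo (f ∘ (m ℕ.+_)) n

  -- The first |v| + n letters of vvv⋯ are v followed by the n-prefix, but
  -- also the n-prefix followed by |v| letters of value r.
  valueₚ-prefix : .{{_ : ℕ.NonZero p}} → ∀ (v : List⁺ (Fin p)) n → ∃ λ r →
    r ℕ.≤ p ℕ.^ length v ℕ.∸ 1 ×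
    v ⁺ₚ ℕ.* p ℕ.^ n ≡ valueₚ (prefix (v ^∞) n) ℕ.* (p ℕ.^ length v ℕ.∸ 1) ℕ.+ r
  -- As the value of `m` letters, `r` is below `p^m`. Adding `V` to both sides turns `V * (p^m - 1)`
  -- into `V * p^m`, after which both sides evaluate the same word of `m + n` letters.
  valueₚ-prefix v n = r , ℕ.<⇒≤pred (valueₚ-applyUpTo< (b ∘ (n ℕ.+_)) m) , ℕ.+-cancelʳ-≡ V _ _ (begin
    v ⁺ₚ ℕ.* p ℕ.^ n ℕ.+ V                    ≡⟨ cong₂ (λ xs ys → valueₚ xs ℕ.* p ℕ.^ n ℕ.+ valueₚ ys)
                                                   (prefix-length v)
                                                   (sym (applyUpTo-cong (^∞-periodic v) n)) ⟩
    valueₚ (prefix b m) ℕ.* p ℕ.^ n ℕ.+ valueₚ (prefix (b ∘ (m ℕ.+_)) n)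
                                              ≡⟨ valueₚ-applyUpTo-+ b m n ⟨
    valueₚ (prefix b (m ℕ.+ n))               ≡⟨ cong (valueₚ ∘ prefix b) (ℕ.+-comm m n) ⟩
    valueₚ (prefix b (n ℕ.+ m))               ≡⟨ valueₚ-applyUpTo-+ b n m ⟩
    -- Writing `p^m` as a successor keeps truncated subtraction away from the ring solver.
    V ℕ.* p ℕ.^ m ℕ.+ r                       ≡⟨ cong (λ k → V ℕ.* k ℕ.+ r) (ℕ.suc-pred (p ℕ.^ m) {{ℕ.m^n≢0 p m}}) ⟨
    V ℕ.* suc (ℕ.pred (p ℕ.^ m)) ℕ.+ r        ≡⟨ rearrange V (ℕ.pred (p ℕ.^ m)) r ⟩
    V ℕ.* (ℕ.pred (p ℕ.^ m)) ℕ.+ r ℕ.+ V      ≡⟨⟩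
    V ℕ.* (p ℕ.^ m ℕ.∸ 1) ℕ.+ r ℕ.+ V         ∎)
    where
    open ≡-Reasoning
    b = v ^∞
    m = length v
    V = valueₚ (prefix b n)
    r = valueₚ (prefix (b ∘ (n ℕ.+_)) m)
    rearrange : ∀ V N r → V ℕ.* suc N ℕ.+ r ≡ V ℕ.* N ℕ.+ r ℕ.+ V
    rearrange = solve-∀

-- Fractions with natural numerators

/-≤ : ∀ a d b e .{{_ : ℕ.NonZero d}} .{{_ : ℕ.NonZero e}} →
      a ℕ.* e ℕ.≤ b ℕ.* d → + a / d ≤ + b / e
/-≤ a d b e h = /-mono-≤ (+ a) d (+ b) e (subst₂ ℤ._≤_ (ℤ.pos-* a e) (ℤ.pos-* b d) (ℤ.+≤+ h))

/-≡ : ∀ a d b e .{{_ : ℕ.NonZero d}} .{{_ : ℕ.NonZero e}} →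
      a ℕ.* e ≡ b ℕ.* d → + a / d ≡ + b / e
/-≡ a d b e h = ≤-antisym (/-≤ a d b e (ℕ.≤-reflexive h)) (/-≤ b e a d (ℕ.≤-reflexive (sym h)))

/-≤-cancel : ∀ a d b e .{{_ : ℕ.NonZero d}} .{{_ : ℕ.NonZero e}} →
             + a / d ≤ + b / e → a ℕ.* e ℕ.≤ b ℕ.* d
/-≤-cancel a d b e h = ℕ.≮⇒≥ λ lt → <-irrefl refl (≤-<-trans h
  (/-mono-< (+ b) e (+ a) d (subst₂ ℤ._<_ (ℤ.pos-* b d) (ℤ.pos-* a e) (ℤ.+<+ lt))))

ι-*-/ : ∀ q a d .{{_ : ℕ.NonZero d}} → ι (+ q) * (+ a / d) ≡ + (q ℕ.* a) / d
ι-*-/ q a (suc d) = toℚᵘ-injective (begin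
  toℚᵘ (ι (+ q) * (+ a / suc d))              ≈⟨ toℚᵘ-homo-* (ι (+ q)) (+ a / suc d) ⟩
  toℚᵘ (ι (+ q)) ℚᵘ.* toℚᵘ (+ a / suc d)      ≈⟨ ℚᵘ.*-cong (toℚᵘ-fromℚᵘ (mkℚᵘ (+ q) 0)) (toℚᵘ-fromℚᵘ (mkℚᵘ (+ a) d)) ⟩
  mkℚᵘ (+ q) 0 ℚᵘ.* mkℚᵘ (+ a) d              ≈⟨ ℚᵘ.*≡* (cong₂ ℤ._*_ (sym (ℤ.pos-* q a)) (cong (λ k → + suc k) (sym (ℕ.+-identityʳ d)))) ⟩
  mkℚᵘ (+ (q ℕ.* a)) d                        ≈⟨ toℚᵘ-fromℚᵘ (mkℚᵘ (+ (q ℕ.* a)) d) ⟨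
  toℚᵘ (+ (q ℕ.* a) / suc d)                  ∎)
  where open ℚᵘ.≃-Reasoning

-- Closeness of the numerators is phrased by two additive inequalities, so that later estimates stay
-- in ℕ and never subtract.
∣/-/∣≤ : ∀ a b c d .{{_ : ℕ.NonZero d}} → a ℕ.≤ b ℕ.+ c → b ℕ.≤ a ℕ.+ c →
         ∣ + a / d - + b / d ∣ ≤ + c / d
∣/-/∣≤ a b c d h₁ h₂ = -≤⇒∣∣≤ (half a b h₁)
  (subst (_≤ + c / d) (solve 2 (λ x y → y :- x := :- (x :- y)) refl (+ a / d) (+ b / d)) (half b a h₂))
  where
  open +-*-Solver
  half : ∀ a b → a ℕ.≤ b ℕ.+ c → + a / d - + b / d ≤ + c / d
  half a b h = begin
    + a / d - + b / d              ≤⟨ +-monoˡ-≤ (- (+ b / d)) (/-≤ a d (b ℕ.+ c) d (ℕ.*-monoˡ-≤ d h)) ⟩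
    + (b ℕ.+ c) / d - + b / d      ≡⟨ cong (_- + b / d) (/-+ (+ b) (+ c) d) ⟨
    + b / d + + c / d - + b / d    ≡⟨ solve 2 (λ x y → x :+ y :- x := y) refl (+ b / d) (+ c / d) ⟩
    + c / d                        ∎
    where open ≤-Reasoning

0≤ι : ∀ n → 0ℚ ≤ ι (+ n)
0≤ι n = /-≤ 0 1 n 1 ℕ.z≤n

0≤‖‖ℚ : ∀ x → 0ℚ ≤ ‖ x ‖ℚ
0≤‖‖ℚ x = 0≤∣p∣ (x - ι (round x))

-- Partial sums, the p-adic absolute value and the distance to the nearest integer

module _ {p : ℕ} (p-prime : Prime p) where

  private
    instance
      p-nonZero : ℕ.NonZero p
      p-nonZero = prime⇒nonZero p-prime

    p^_≢0 : ∀ n → ℕ.NonZero (p ℕ.^ n)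
    p^ n ≢0 = ℕ.m^n≢0 p n

    _⊘_ : ℕ → ℕ → ℚ
    a ⊘ n = over p-prime (+ a) n

  -- Horner's scheme: over the denominator `p^(n+1)`, the old numerator is multiplied by `p` and the
  -- new letter is added, which is the effect of appending that letter to the word.
  partialSum≡ : ∀ a n → partialSum p-prime a n ≡ valueₚ (applyUpTo a n) ⊘ n
  partialSum≡ a zero    = refl
  partialSum≡ a (suc n) = begin
    partialSum p-prime a n + x ⊘ suc n  ≡⟨ cong (_+ x ⊘ suc n) (partialSum≡ a n) ⟩
    V ⊘ n + x ⊘ suc n                   ≡⟨ cong (_+ x ⊘ suc n) (/-≡ V (p ℕ.^ n) (V ℕ.* p) (p ℕ.^ suc n)
                                             {{p^ n ≢0}} {{p^ suc n ≢0}} (sym (ℕ.*-assoc V p (p ℕ.^ n)))) ⟩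
    (V ℕ.* p) ⊘ suc n + x ⊘ suc n       ≡⟨ /-+ (+ (V ℕ.* p)) (+ x) (p ℕ.^ suc n) {{p^ suc n ≢0}} ⟩
    (V ℕ.* p ℕ.+ x) ⊘ suc n             ≡⟨ cong (_⊘ suc n) (sym step) ⟩
    valueₚ (applyUpTo a (suc n)) ⊘ suc n  ∎
    where
    open ≡-Reasoning
    x = toℕ (a n)
    V = valueₚ (applyUpTo a n)
    step : valueₚ (applyUpTo a (suc n)) ≡ V ℕ.* p ℕ.+ x
    step = begin
      valueₚ (applyUpTo a (suc n))             ≡⟨ cong valueₚ (applyUpTo-∷ʳ a n) ⟨
      valueₚ (applyUpTo a n ++ a n ∷ [])       ≡⟨ valueₚ-++ (applyUpTo a n) (a n ∷ []) ⟩
      V ℕ.* (p ℕ.* 1) ℕ.+ (x ℕ.* 1 ℕ.+ 0)      ≡⟨ cong₂ (λ s t → V ℕ.* s ℕ.+ t) (ℕ.*-identityʳ p)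
                                                   (trans (ℕ.+-identityʳ _) (ℕ.*-identityʳ x)) ⟩
      V ℕ.* p ℕ.+ x                            ∎

  -- If the valuation `k` were below `n`, then `p^(k+1)` would divide `p^n` and hence `q`, against
  -- the maximality of `k`.
  p^∣⇒≤-valuation : ∀ q .{{_ : ℕ.NonZero q}} n → p ℕ.^ n ∣ q → n ℕ.≤ proj₁ (valuation p-prime q)
  p^∣⇒≤-valuation q n pⁿ∣q = ℕ.≮⇒≥ λ k<n → proj₂ (proj₂ (valuation p-prime q)) (∣-trans
    (subst (λ i → p ℕ.^ suc k ∣ p ℕ.^ i) (ℕ.m+[n∸m]≡n k<n)
      (subst (p ℕ.^ suc k ∣_) (sym (ℕ.^-distribˡ-+-* p (suc k) (n ℕ.∸ suc k))) (m∣m*n _)))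
    pⁿ∣q)
    where k = proj₁ (valuation p-prime q)

  -- The valuation `k` of `q` is at least `n`, so `q / p^k` is at most `d`. The factorisation is a
  -- separate equation so that the bound also applies to `suc (ℕ.pred q)`.
  q*∣q∣ₚ≤ : ∀ q .{{_ : ℕ.NonZero q}} d n → q ≡ d ℕ.* p ℕ.^ n → ι (+ q) * ∣_∣ₚ p-prime q ≤ ι (+ d)
  q*∣q∣ₚ≤ q d n eq = begin
    ι (+ q) * 1 ⊘ k      ≡⟨ ι-*-/ q 1 (p ℕ.^ k) {{p^ k ≢0}} ⟩
    (q ℕ.* 1) ⊘ k        ≤⟨ /-≤ (q ℕ.* 1) (p ℕ.^ k) d 1 {{p^ k ≢0}} q≤ ⟩
    ι (+ d)              ∎
    where
    open ≤-Reasoning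
    k = proj₁ (valuation p-prime q)
    q≤ : q ℕ.* 1 ℕ.* 1 ℕ.≤ d ℕ.* p ℕ.^ k
    q≤ = subst (ℕ._≤ d ℕ.* p ℕ.^ k) (sym (trans (ℕ.*-identityʳ (q ℕ.* 1)) (trans (ℕ.*-identityʳ q) eq)))
      (ℕ.*-monoʳ-≤ d (ℕ.^-monoʳ-≤ p (p^∣⇒≤-valuation q n (subst (p ℕ.^ n ∣_) (sym eq) (n∣m*n d)))))

  -- The two hypotheses place `u/d` in the interval from `V p^-L` to `(V+1) p^-L`. The truncated
  -- expansion after its first `n` letters lies there too, so the two differ by at most `p^-L`.
  -- Multiplication by `d p^t` makes `u/d` an integer. The bound is uniform in `e`, so it holds for
  -- all truncations that contain the block.
  ‖q·partialSum‖≤ : ∀ (a : ℕ → Fin p) n L d u t →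
    let V = valueₚ (applyUpTo (a ∘ (n ℕ.+_)) L) in
    V ℕ.* d ℕ.≤ u ℕ.* p ℕ.^ L → u ℕ.* p ℕ.^ L ℕ.≤ V ℕ.* d ℕ.+ d → ∀ e →
    ‖ ι (+ (d ℕ.* p ℕ.^ (n ℕ.+ t))) * partialSum p-prime a (n ℕ.+ (L ℕ.+ e)) ‖ℚ ≤ (d ℕ.* p ℕ.^ t) ⊘ L
  ‖q·partialSum‖≤ a n L d u t lower upper e = begin
    ‖ ι (+ q) * partialSum p-prime a s ‖ℚ    ≤⟨ ‖‖ℚ-minimal (ι (+ q) * partialSum p-prime a s) (+ z) ⟩
    ∣ ι (+ q) * partialSum p-prime a s - ι (+ z) ∣
      ≡⟨ cong₂ (λ x y → ∣ x - y ∣)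
           (trans (cong (ι (+ q) *_) (partialSum≡ a s)) (ι-*-/ q A (p ℕ.^ s) {{p^ s ≢0}}))
           (/-≡ z 1 (z ℕ.* p ℕ.^ s) (p ℕ.^ s) {{_}} {{p^ s ≢0}} (sym (ℕ.*-identityʳ _))) ⟩
    ∣ (q ℕ.* A) ⊘ s - (z ℕ.* p ℕ.^ s) ⊘ s ∣  ≤⟨ ∣/-/∣≤ (q ℕ.* A) (z ℕ.* p ℕ.^ s) C (p ℕ.^ s) {{p^ s ≢0}} above below ⟩
    C ⊘ s                                    ≡⟨ /-≡ C (p ℕ.^ s) (d ℕ.* T) (p ℕ.^ L) {{p^ s ≢0}} {{p^ L ≢0}}
                                                  (trans (C-scale T N d E Λ) (cong (d ℕ.* T ℕ.*_) (sym p^s))) ⟩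
    (d ℕ.* T) ⊘ L                            ∎
    where
    open ≤-Reasoning
    s = n ℕ.+ (L ℕ.+ e)
    T = p ℕ.^ t
    N = p ℕ.^ n
    Λ = p ℕ.^ L
    E = p ℕ.^ e
    q = d ℕ.* p ℕ.^ (n ℕ.+ t)
    A = valueₚ (applyUpTo a s)
    P = valueₚ (applyUpTo a n)
    V = valueₚ (applyUpTo (a ∘ (n ℕ.+_)) L)
    R = valueₚ (applyUpTo (λ i → a (n ℕ.+ (L ℕ.+ i))) e)
    -- This is `d p^t (P + u/d)`: in `q` times the partial sum, everything after the first `n`
    -- letters is replaced by `u/d`. Below, `C` is the error `d p^t p^-L` over the denominator
    -- `p^s`.
    z = T ℕ.* (d ℕ.* P ℕ.+ u)
    C = T ℕ.* N ℕ.* (d ℕ.* E)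

    p^s : p ℕ.^ s ≡ N ℕ.* (Λ ℕ.* E)
    p^s = trans (ℕ.^-distribˡ-+-* p n (L ℕ.+ e)) (cong (N ℕ.*_) (ℕ.^-distribˡ-+-* p L e))

    C-scale : ∀ T N d E Λ → T ℕ.* N ℕ.* (d ℕ.* E) ℕ.* Λ ≡ d ℕ.* T ℕ.* (N ℕ.* (Λ ℕ.* E))
    C-scale = solve-∀

    A≡ : A ≡ P ℕ.* (Λ ℕ.* E) ℕ.+ (V ℕ.* E ℕ.+ R)
    A≡ = trans (valueₚ-applyUpTo-+ a n (L ℕ.+ e))
      (cong₂ (λ x y → P ℕ.* x ℕ.+ y) (ℕ.^-distribˡ-+-* p L e) (valueₚ-applyUpTo-+ (a ∘ (n ℕ.+_)) L e))

    -- After the factor `T * N` is taken out, `M` is common to `q * A` and `z * p^s`; only `x` and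
    -- `y` remain to be compared.
    M = d ℕ.* (P ℕ.* (Λ ℕ.* E))
    x = V ℕ.* d ℕ.* E ℕ.+ d ℕ.* R
    y = u ℕ.* Λ ℕ.* E

    qA≡ : q ℕ.* A ≡ T ℕ.* N ℕ.* (M ℕ.+ x)
    qA≡ = trans (cong₂ (λ k A → d ℕ.* k ℕ.* A) (ℕ.^-distribˡ-+-* p n t) A≡) (rearrange d N T P Λ E V R)
      where
      rearrange : ∀ d N T P Λ E V R → d ℕ.* (N ℕ.* T) ℕ.* (P ℕ.* (Λ ℕ.* E) ℕ.+ (V ℕ.* E ℕ.+ R)) ≡
                  T ℕ.* N ℕ.* (d ℕ.* (P ℕ.* (Λ ℕ.* E)) ℕ.+ (V ℕ.* d ℕ.* E ℕ.+ d ℕ.* R))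
      rearrange = solve-∀

    zp^s≡ : z ℕ.* p ℕ.^ s ≡ T ℕ.* N ℕ.* (M ℕ.+ y)
    zp^s≡ = trans (cong (z ℕ.*_) p^s) (rearrange d N T P Λ E u)
      where
      rearrange : ∀ d N T P Λ E u → T ℕ.* (d ℕ.* P ℕ.+ u) ℕ.* (N ℕ.* (Λ ℕ.* E)) ≡
                  T ℕ.* N ℕ.* (d ℕ.* (P ℕ.* (Λ ℕ.* E)) ℕ.+ u ℕ.* Λ ℕ.* E)
      rearrange = solve-∀

    scale : ∀ {x y} → x ℕ.≤ y ℕ.+ d ℕ.* E → T ℕ.* N ℕ.* (M ℕ.+ x) ℕ.≤ T ℕ.* N ℕ.* (M ℕ.+ y) ℕ.+ C
    scale {x} {y} h = ℕ.≤-trans (ℕ.*-monoʳ-≤ (T ℕ.* N) (ℕ.+-monoʳ-≤ M h))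
      (ℕ.≤-reflexive (distrib (T ℕ.* N) M y (d ℕ.* E)))
      where
      distrib : ∀ k M y c → k ℕ.* (M ℕ.+ (y ℕ.+ c)) ≡ k ℕ.* (M ℕ.+ y) ℕ.+ k ℕ.* c
      distrib = solve-∀

    -- Here the slack `d * E` absorbs the letters after the block, as `R` is below `p^e`. In `below`
    -- it absorbs the extra `d` in `upper`.
    above : q ℕ.* A ℕ.≤ z ℕ.* p ℕ.^ s ℕ.+ C
    above = subst₂ ℕ._≤_ (sym qA≡) (cong (ℕ._+ C) (sym zp^s≡)) (scale
      (ℕ.+-mono-≤ (ℕ.*-monoˡ-≤ E lower) (ℕ.*-monoʳ-≤ d (ℕ.<⇒≤ (valueₚ-applyUpTo< _ e)))))

    below : z ℕ.* p ℕ.^ s ℕ.≤ q ℕ.* A ℕ.+ C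
    below = subst₂ ℕ._≤_ (sym zp^s≡) (cong (ℕ._+ C) (sym qA≡)) (scale
      (ℕ.≤-trans (ℕ.*-monoˡ-≤ E upper) (ℕ.≤-trans (ℕ.≤-reflexive (ℕ.*-distribʳ-+ E (V ℕ.* d) d))
        (ℕ.+-monoˡ-≤ (d ℕ.* E) (ℕ.m≤m+n (V ℕ.* d ℕ.* E) (d ℕ.* R))))))

  -- The rational number with expansion `0.vvv⋯`

  record Fraction (v : List⁺ (Fin p)) : Set where
    field
      d u : ℕ
      d≢0 : ℕ.NonZero d
      -- Together with `upper`, this puts `u/d` between the `n`-digit truncation of `0.vvv⋯` and
      -- that truncation plus `p^-n`. Equality occurs: if all letters are `p - 1`, then `u/d` is 1
      -- and is the upper end.
      lower : ∀ n → valueₚ (prefix (v ^∞) n) ℕ.* d ℕ.≤ u ℕ.* p ℕ.^ n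
      upper : ∀ n → u ℕ.* p ℕ.^ n ℕ.≤ valueₚ (prefix (v ^∞) n) ℕ.* d ℕ.+ d
      d≤ : ∀ ℓ → ratio p-prime v ≤ ι (+ (p ℕ.^ ℓ)) → d ℕ.≤ p ℕ.^ ℓ

  -- The quotients of `p^m - 1` and `v ⁺ₚ` by their gcd `g` serve as `d` and `u`. Each inequality is
  -- proved after multiplication by `g`, where `d * g` and `u * g` become the original numbers and
  -- `valueₚ-prefix` applies.
  fraction : ∀ v → Fraction v
  fraction v with gcd[m,n]∣m (p ℕ.^ length v ℕ.∸ 1) (v ⁺ₚ) | gcd[m,n]∣n (p ℕ.^ length v ℕ.∸ 1) (v ⁺ₚ)
  ... | divides d N≡dg | divides u v≡ug = record
    { d = d
    ; u = u
    ; d≢0 = ℕ.≢-nonZero λ { refl → p^m∸1≢0 p-prime v N≡dg }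
    ; lower = λ n → ℕ.*-cancelʳ-≤ _ _ g (begin
        V n ℕ.* d ℕ.* g            ≤⟨ ℕ.m≤m+n _ (r n) ⟩
        V n ℕ.* d ℕ.* g ℕ.+ r n    ≡⟨ expand n ⟨
        u ℕ.* p ℕ.^ n ℕ.* g        ∎)
    ; upper = λ n → ℕ.*-cancelʳ-≤ _ _ g (begin
        u ℕ.* p ℕ.^ n ℕ.* g              ≡⟨ expand n ⟩
        V n ℕ.* d ℕ.* g ℕ.+ r n          ≤⟨ ℕ.+-monoʳ-≤ (V n ℕ.* d ℕ.* g) (r≤ n) ⟩
        V n ℕ.* d ℕ.* g ℕ.+ d ℕ.* g      ≡⟨ ℕ.*-distribʳ-+ g (V n ℕ.* d) d ⟨
        (V n ℕ.* d ℕ.+ d) ℕ.* g          ∎)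
    ; d≤ = λ ℓ h → ℕ.*-cancelʳ-≤ _ _ g (begin
        d ℕ.* g          ≡⟨ N≡dg ⟨
        N                ≡⟨ ℕ.*-identityʳ N ⟨
        N ℕ.* 1          ≤⟨ /-≤-cancel N g (p ℕ.^ ℓ) 1 h ⟩
        p ℕ.^ ℓ ℕ.* g    ∎)
    }
    where
    open ℕ.≤-Reasoning
    N = p ℕ.^ length v ℕ.∸ 1
    g = gcd N (v ⁺ₚ)
    instance
      g≢0 : ℕ.NonZero g
      g≢0 = ℕ.≢-nonZero (gcd[m,n]≢0 N (v ⁺ₚ) (inj₁ (p^m∸1≢0 p-prime v)))
    V = λ n → valueₚ (prefix (v ^∞) n)
    r = λ n → proj₁ (valueₚ-prefix v n)
    r≤ : ∀ n → r n ℕ.≤ d ℕ.* g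
    r≤ n = subst (r n ℕ.≤_) N≡dg (proj₁ (proj₂ (valueₚ-prefix v n)))
    swap : ∀ u k g → u ℕ.* k ℕ.* g ≡ u ℕ.* g ℕ.* k
    swap = solve-∀
    expand : ∀ n → u ℕ.* p ℕ.^ n ℕ.* g ≡ V n ℕ.* d ℕ.* g ℕ.+ r n
    expand n = begin-equality
      u ℕ.* p ℕ.^ n ℕ.* g          ≡⟨ swap u (p ℕ.^ n) g ⟩
      u ℕ.* g ℕ.* p ℕ.^ n          ≡⟨ cong (ℕ._* p ℕ.^ n) v≡ug ⟨
      v ⁺ₚ ℕ.* p ℕ.^ n             ≡⟨ proj₂ (proj₂ (valueₚ-prefix v n)) ⟩
      V n ℕ.* N ℕ.+ r n            ≡⟨ cong (λ k → V n ℕ.* k ℕ.+ r n) N≡dg ⟩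
      V n ℕ.* (d ℕ.* g) ℕ.+ r n    ≡⟨ cong (ℕ._+ r n) (ℕ.*-assoc (V n) d g) ⟨
      V n ℕ.* d ℕ.* g ℕ.+ r n      ∎

  -- The terms `q |q|_p ‖qx‖` and their lower limit

  pLC-term : ℝ → ℕ → ℝ
  pLC-term x n = (ι (+ suc n) * ∣_∣ₚ p-prime (suc n)) · ‖ ι (+ suc n) · x ‖

  pLC-term-nonNeg : ∀ x n s → 0ℚ ≤ seq (pLC-term x n) s
  pLC-term-nonNeg x n s = begin
    0ℚ                          ≡⟨ *-zeroʳ c ⟨
    c * 0ℚ                      ≤⟨ *-monoˡ-≤-nonNeg c {{nonNegative 0≤c}} (0≤‖‖ℚ (ι (+ suc n) * seq x s)) ⟩
    c * ‖ ι (+ suc n) * seq x s ‖ℚ  ∎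
    where
    open ≤-Reasoning
    k = proj₁ (valuation p-prime (suc n))
    c = ι (+ suc n) * 1 ⊘ k
    0≤c : 0ℚ ≤ c
    0≤c = subst (0ℚ ≤_) (sym (ι-*-/ (suc n) 1 (p ℕ.^ k) {{p^ k ≢0}})) (over-nonNeg p-prime (suc n ℕ.* 1) k)

  -- The terms are nonnegative, so they exceed `-ε` with gap `ε` from the start. For the other half,
  -- `M` is chosen with `p^-M` below `ε`.
  small-terms⇒pLC : ∀ x →
    (∀ N M → ∃ λ n → N ℕ.≤ n × ∃ λ S → ∀ s → S ℕ.≤ s → seq (pLC-term x n) s ≤ 1 ⊘ M) → pLC p-prime x
  small-terms⇒pLC x small ε ε>0 =
    (0 , λ n _ → ε , ε>0 , 0 , λ s _ →
      subst (_≤ seq (pLC-term x n) s) (solve 1 (λ e → con 0ℚ := con 0ℚ :- e :+ e) refl ε)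
        (pLC-term-nonNeg x n s)) ,
    frequently
    where
    open +-*-Solver
    frequently : ∀ N → ∃ λ n → N ℕ.≤ n × pLC-term x n <ᵣ fromℚ (0ℚ + ε)
    frequently N with over-small p-prime ε ε>0
    ... | M , b<ε with small N M
    ...   | n , N≤n , S , h = n , N≤n , ε - b ,
            -- The strict order on ℝ asks for a positive rational gap; a term of at most `b` leaves
            -- `ε - b`.
            subst (_< ε - b) (+-inverseʳ b) (+-monoˡ-< (- b) b<ε) , S , λ s S≤s →
            subst (seq (pLC-term x n) s + (ε - b) ≤_)
              (solve 2 (λ b e → b :+ (e :- b) := con 0ℚ :+ e) refl b ε)
              (+-monoˡ-≤ (ε - b) (h s S≤s))
      where b = 1 ⊘ M

  -- The multiplier is `q = d p^(n+N)`: since `p^N` exceeds `N`, so does `q`. The product of the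
  -- bounds `d` and `d p^N p^-L` is at most `p^(N+2ℓ-L)`, and `long` makes this at most `p^-M`.
  pLC-term≤ : ∀ a (v : List⁺ (Fin p)) k ℓ → (toList v ++ prefix (v ^∞) k) OccursIn a →
    ratio p-prime v ≤ ι (+ (p ℕ.^ ℓ)) → ∀ N M → N ℕ.+ M ℕ.+ 2 ℕ.* ℓ ℕ.≤ length v ℕ.+ k →
    ∃ λ n → N ℕ.≤ n × ∃ λ S → ∀ s → S ℕ.≤ s → seq (pLC-term (toReal p-prime a) n) s ≤ 1 ⊘ M
  -- The predecessor appears because entry `i` of the sequence belongs to the multiplier `i + 1`.
  -- From index `n + L` on, the partial sums contain the whole block.
  pLC-term≤ a v k ℓ (n , occ) ratio≤ N M long = ℕ.pred q , N≤pred , n ℕ.+ L , bound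
    where
    open Fraction (fraction v)
    L = length v ℕ.+ k
    U = prefix (v ^∞) L

    U≡ : U ≡ applyUpTo (a ∘ (n ℕ.+_)) L
    U≡ = trans (sym (prefix-+ v k)) (trans (lookup⇒applyUpTo (a ∘ (n ℕ.+_)) _ occ)
      (cong (applyUpTo (a ∘ (n ℕ.+_))) (trans (cong List.length (prefix-+ v k)) (length-applyUpTo (v ^∞) L))))

    q = d ℕ.* p ℕ.^ (n ℕ.+ N)
    instance
      q≢0 : ℕ.NonZero q
      q≢0 = ℕ.m*n≢0 d (p ℕ.^ (n ℕ.+ N)) {{d≢0}} {{p^ (n ℕ.+ N) ≢0}}

    suc-pred : suc (ℕ.pred q) ≡ q
    suc-pred = ℕ.suc-pred q

    N≤pred : N ℕ.≤ ℕ.pred q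
    N≤pred = ℕ.<⇒≤pred (ℕ.<-≤-trans (n<p^n p-prime N) (ℕ.≤-trans
      (ℕ.^-monoʳ-≤ p (ℕ.m≤n+m N n)) (ℕ.m≤n*m (p ℕ.^ (n ℕ.+ N)) d {{d≢0}})))

    d*d*p^N≤ : d ℕ.* (d ℕ.* p ℕ.^ N) ℕ.* p ℕ.^ M ℕ.≤ 1 ℕ.* p ℕ.^ L
    d*d*p^N≤ = begin
      d ℕ.* (d ℕ.* p ℕ.^ N) ℕ.* p ℕ.^ M
        ≤⟨ ℕ.*-monoˡ-≤ (p ℕ.^ M) (ℕ.*-mono-≤ (d≤ ℓ ratio≤) (ℕ.*-monoˡ-≤ (p ℕ.^ N) (d≤ ℓ ratio≤))) ⟩
      p ℕ.^ ℓ ℕ.* (p ℕ.^ ℓ ℕ.* p ℕ.^ N) ℕ.* p ℕ.^ M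
        ≡⟨ rearrange (p ℕ.^ ℓ) (p ℕ.^ N) (p ℕ.^ M) ⟩
      p ℕ.^ N ℕ.* p ℕ.^ M ℕ.* (p ℕ.^ ℓ ℕ.* p ℕ.^ ℓ)
        ≡⟨ cong₂ ℕ._*_ (ℕ.^-distribˡ-+-* p N M)
             (trans (cong (λ i → p ℕ.^ (ℓ ℕ.+ i)) (ℕ.+-identityʳ ℓ)) (ℕ.^-distribˡ-+-* p ℓ ℓ)) ⟨
      p ℕ.^ (N ℕ.+ M) ℕ.* p ℕ.^ (2 ℕ.* ℓ)
        ≡⟨ ℕ.^-distribˡ-+-* p (N ℕ.+ M) (2 ℕ.* ℓ) ⟨
      p ℕ.^ (N ℕ.+ M ℕ.+ 2 ℕ.* ℓ)
        ≤⟨ ℕ.^-monoʳ-≤ p long ⟩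
      p ℕ.^ L
        ≡⟨ ℕ.*-identityˡ (p ℕ.^ L) ⟨
      1 ℕ.* p ℕ.^ L  ∎
      where
      open ℕ.≤-Reasoning
      rearrange : ∀ x y z → x ℕ.* (x ℕ.* y) ℕ.* z ≡ y ℕ.* z ℕ.* (x ℕ.* x)
      rearrange = solve-∀

    V = valueₚ (applyUpTo (a ∘ (n ℕ.+_)) L)

    near : ∀ s → n ℕ.+ L ℕ.≤ s → ‖ ι (+ q) * partialSum p-prime a s ‖ℚ ≤ (d ℕ.* p ℕ.^ N) ⊘ L
    near s h = subst (λ s → ‖ ι (+ q) * partialSum p-prime a s ‖ℚ ≤ (d ℕ.* p ℕ.^ N) ⊘ L)
      (trans (sym (ℕ.+-assoc n L _)) (ℕ.m+[n∸m]≡n h))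
      (‖q·partialSum‖≤ a n L d u N
        (subst (λ U → valueₚ U ℕ.* d ℕ.≤ u ℕ.* p ℕ.^ L) U≡ (lower L))
        (subst (λ U → u ℕ.* p ℕ.^ L ℕ.≤ valueₚ U ℕ.* d ℕ.+ d) U≡ (upper L))
        (s ℕ.∸ (n ℕ.+ L)))

    bound : ∀ s → n ℕ.+ L ℕ.≤ s → seq (pLC-term (toReal p-prime a) (ℕ.pred q)) s ≤ 1 ⊘ M
    bound s h = begin
      ι (+ q′) * ∣_∣ₚ p-prime q′ * ‖ ι (+ q′) * S ‖ℚ
        ≤⟨ *-monoʳ-≤-nonNeg ‖ ι (+ q′) * S ‖ℚ {{nonNegative (0≤‖‖ℚ (ι (+ q′) * S))}} (q*∣q∣ₚ≤ q′ d (n ℕ.+ N) suc-pred) ⟩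
      ι (+ d) * ‖ ι (+ q′) * S ‖ℚ
        ≡⟨ cong (λ q → ι (+ d) * ‖ ι (+ q) * S ‖ℚ) suc-pred ⟩
      ι (+ d) * ‖ ι (+ q) * S ‖ℚ
        ≤⟨ *-monoˡ-≤-nonNeg (ι (+ d)) {{nonNegative (0≤ι d)}} (near s h) ⟩
      ι (+ d) * (d ℕ.* p ℕ.^ N) ⊘ L
        ≡⟨ ι-*-/ d (d ℕ.* p ℕ.^ N) (p ℕ.^ L) {{p^ L ≢0}} ⟩
      (d ℕ.* (d ℕ.* p ℕ.^ N)) ⊘ L
        ≤⟨ /-≤ (d ℕ.* (d ℕ.* p ℕ.^ N)) (p ℕ.^ L) 1 (p ℕ.^ M) {{p^ L ≢0}} {{p^ M ≢0}} d*d*p^N≤ ⟩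
      1 ⊘ M  ∎
      where
      open ≤-Reasoning
      q′ = suc (ℕ.pred q)
      S = partialSum p-prime a s

-- From the growth hypothesis to the conjecture

+≤-⇒+≤ : ∀ k m n → + k ℤ.≤ + m ℤ.- + n → k ℕ.+ n ℕ.≤ m
+≤-⇒+≤ k m n h = ℤ.drop‿+≤+ (subst (+ (k ℕ.+ n) ℤ.≤_) (begin
  + m ℤ.- + n ℤ.+ + n          ≡⟨ ℤ.+-assoc (+ m) (ℤ.- + n) (+ n) ⟩
  + m ℤ.+ (ℤ.- + n ℤ.+ + n)    ≡⟨ cong (ℤ._+_ (+ m)) (ℤ.+-inverseˡ (+ n)) ⟩
  + m ℤ.+ + 0                  ≡⟨ ℤ.+-identityʳ (+ m) ⟩
  + m                          ∎) (ℤ.+-monoˡ-≤ (+ n) h))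
  where open ≡-Reasoning

theorem2p3 : ∀ {p : ℕ} (p-prime : Prime p) (a : ℕ → Fin p)
    (w : ℕ → List⁺ (Fin p)) (δ : ℕ → ℝ) →
    (∀ j → fromℚ 0ℚ <ᵣ δ j) →
    (⌊mδ⌋ : ℕ → ℕ) →
    (∀ j → IsFloor (ι (+ length (w j)) · δ j) (+ ⌊mδ⌋ j)) →
    (∀ j → (toList (w j) ++ prefix (w j ^∞) (⌊mδ⌋ j)) OccursIn a) →
    (ℓ : ℕ → ℕ) →
    (∀ j → p^[_-1] p-prime (ℓ j) ≤ ratio p-prime (w j) × ratio p-prime (w j) ≤ ι (+ (p ℕ.^ ℓ j))) →
    TendsTo+∞ (λ j → + length (w j) ℤ.+ + ⌊mδ⌋ j ℤ.- + (2 ℕ.* ℓ j)) →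
    pLC p-prime (toReal p-prime a)
theorem2p3 p-prime a w δ δ>0 ⌊mδ⌋ isFloor occurs ℓ ratio-bounds long =
  -- For each pair `N`, `M` a single `j` suffices: one for which the block is at least `N + M`
  -- letters longer than `2ℓ`.
  small-terms⇒pLC p-prime (toReal p-prime a) λ N M →
    let j , h = long (+ (N ℕ.+ M)) in
    pLC-term≤ p-prime a (w j) (⌊mδ⌋ j) (ℓ j) (occurs j) (proj₂ (ratio-bounds j)) N M
      (+≤-⇒+≤ (N ℕ.+ M) (length (w j) ℕ.+ ⌊mδ⌋ j) (2 ℕ.* ℓ j) (h j ℕ.≤-refl))
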